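{- Let $\mathcal{L}_a$ and $\mathcal{L}_b$ be logics with disjoint signatures, each characterizable by a single logical matrix. If $\mathcal{L}_a$ conservatively extends a logic $\mathcal{L}_1$ and $\mathcal{L}_b$ conservatively extends a logic $\mathcal{L}_2$, then $\mathcal{L}_a\bullet\mathcal{L}_b$ conservatively extends $\mathcal{L}_1\bullet\mathcal{L}_2$.
   Context: Fix a denumerable set $P=\{p_1,p_2,\dots\}$ of sentential variables; all logics here are over languages generated by $P$. A signature $\Sigma$ is a set of connective symbols, each with an arity in $\{0,1,2,\dots\}$; $L_\Sigma(P)$ is the set of formulas freely generated by $P$ over $\Sigma$. A logic over $L_\Sigma(P)$ is a pair $\langle L_\Sigma(P),\vdash\rangle$ with $\vdash\,\subseteq \mathcal{P}(L_\Sigma(P))\times L_\Sigma(P)$ satisfying: (R) $\Gamma\cup\{C\}\vdash C$; (M) $\Gamma\vdash C$ implies $\Gamma\cup\Delta\vdash C$; (T) if $\Gamma\vdash D$ for all $D\in\Delta$ and $\Gamma\cup\Delta\vdash C$, then $\Gamma\vdash C$; (SI) $\Gamma\vdash C$ implies $\Gamma^\sigma\vdash C^\sigma$ for every substitution $\sigma:P\to L_\Sigma(P)$. A logic $\mathcal{L}'=\langle L_{\Sigma'}(P),\vdash'\rangle$ extends $\mathcal{L}=\langle L_\Sigma(P),\vdash\rangle$ if $\Sigma\subseteq\Sigma'$ and $\vdash\,\subseteq\,\vdash'$; the extension is conservative if moreover, for all $\Gamma\cup\{C\}\subseteq L_\Sigma(P)$, $\Gamma\vdash C$ iff $\Gamma\vdash'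 C$. A logical matrix over $L_\Sigma(P)$ consists of a set $V$ of truth-values, a subset $D\subseteq V$ of designated values, and for each $k$-place $c\in\Sigma$ an operation $\tilde c:V^k\to V$. A valuation is a map $v:L_\Sigma(P)\to V$ with $v(c(C_1,\dots,C_k))=\tilde c(v(C_1),\dots,v(C_k))$ for all $c\in\Sigma$. A logic $\langle L_\Sigma(P),\vdash\rangle$ is characterized by the single matrix if: $\Gamma\vdash C$ iff every valuation $v$ with $v(G)\in D$ for all $G\in\Gamma$ has $v(C)\in D$. The fibring $\mathcal{L}_a\bullet\mathcal{L}_b$ of logics $\mathcal{L}_a=\langle L_{\Sigma_a}(P),\vdash_a\rangle$ and $\mathcal{L}_b=\langle L_{\Sigma_b}(P),\vdash_b\rangle$ is the logic over $L_{\Sigma_a\cup\Sigma_b}(P)$ whose consequence relation is the smallest one (satisfying R, M, T, SI over that language) that includes both $\vdash_a$ and $\vdash_b$.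
   Formalization: The claim as stated is false in general; two hypotheses are added: each of the two matrices has at least one designated value, and the signatures of L_1 and L_2 are countable (those of L_a and L_b stay arbitrary). -}

module Defs where

open import Data.Nat.Base using (ℕ)
open import Data.Product.Base using (_×_; ∃; ∃-syntax)
open import Data.Sum.Base using (inj₁; inj₂)
open import Data.Vec.Base as Vec using (Vec; []; _∷_)
open import Function.Bundles using (_⇔_)
open import Level using (0ℓ)
open import Relation.Binary.PropositionalEquality.Core using (_≡_)
open import Relation.Unary using (Pred; _∈_; _⊆_; _≐_; _∪_; ｛_｝)

-- A signature is a subset of an ambient type Sym of symbols, whose arities
-- are given by ar; inclusion, union and disjointness of signatures are those
-- of Relation.Unary.

Signature : Set → Set₁
Signature Sym = Pred Sym 0ℓ

private variable
  Sym : Set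
  ar : Sym → ℕ
  S S′ : Signature Sym

-- Consequence relations only see countably many variables, so conservativity
-- of fibring can fail when the language has uncountably many formulas.

Countable : Signature Sym → Set
Countable {Sym} S =
  ∃ λ (code : Sym → ℕ) → ∀ {c d} → c ∈ S → d ∈ S → code c ≡ code d → c ≡ d

-- The sentential variables p₁, p₂, … are indexed by ℕ.  Membership of c in S
-- is irrelevant, so a formula depends only on the symbols occurring in it.

data Formula {Sym : Set} (ar : Sym → ℕ) (S : Signature Sym) : Set where
  var : ℕ → Formula ar S
  app : (c : Sym) → .(c ∈ S) → Vec (Formula ar S) (ar c) → Formula ar S

FormulaSet : {Sym : Set} → (Sym → ℕ) → Signature Sym → Set₁
FormulaSet ar S = Pred (Formula ar S) 0ℓ

image : {A B : Set} → (A → B) → Pred A 0ℓ → Pred B 0ℓ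
image f P y = ∃[ x ] x ∈ P × f x ≡ y

mutual
  subst : (ℕ → Formula ar S) → Formula ar S → Formula ar S
  subst σ (var p)      = σ p
  subst σ (app c m As) = app c m (subst* σ As)

  subst* : ∀ {n} → (ℕ → Formula ar S) → Vec (Formula ar S) n → Vec (Formula ar S) n
  subst* σ []       = []
  subst* σ (A ∷ As) = subst σ A ∷ subst* σ As

-- The inclusion of languages induced by an inclusion of signatures.

mutual
  embed : S ⊆ S′ → Formula ar S → Formula ar S′
  embed i (var p)      = var p
  embed i (app c m As) = app c (i m) (embed* i As)

  embed* : ∀ {n} → S ⊆ S′ → Vec (Formula ar S) n → Vec (Formula ar S′) n
  embed* i []       = []
  embed* i (A ∷ As) = embed i A ∷ embed* i As

-- Sets of formulas are predicates, for which extensional equality _≐_ is not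
-- _≡_; resp makes _⊢_ a relation on sets up to _≐_.

record Logic {Sym : Set} (ar : Sym → ℕ) (S : Signature Sym) : Set₂ where
  infix 4 _⊢_
  field
    _⊢_  : FormulaSet ar S → Formula ar S → Set₁
    resp : ∀ {Γ Δ C} → Γ ≐ Δ → Γ ⊢ C → Δ ⊢ C
    R    : ∀ {Γ C} → Γ ∪ ｛ C ｝ ⊢ C
    M    : ∀ {Γ Δ C} → Γ ⊢ C → Γ ∪ Δ ⊢ C
    T    : ∀ {Γ Δ C} → (∀ {D} → D ∈ Δ → Γ ⊢ D) → Γ ∪ Δ ⊢ C → Γ ⊢ C
    SI   : ∀ {Γ C} σ → Γ ⊢ C → image (subst σ) Γ ⊢ subst σ C

record _Extends_ {Sym : Set} {ar : Sym → ℕ} {S′ S : Signature Sym}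
                 (L′ : Logic ar S′) (L : Logic ar S) : Set₁ where
  private
    module L′ = Logic L′
    module L  = Logic L
  field
    incl : S ⊆ S′
    mono : ∀ {Γ C} → Γ L.⊢ C → image (embed incl) Γ L′.⊢ embed incl C

record _ConservativelyExtends_ {Sym : Set} {ar : Sym → ℕ} {S′ S : Signature Sym}
                               (L′ : Logic ar S′) (L : Logic ar S) : Set₁ where
  private
    module L′ = Logic L′
    module L  = Logic L
  field
    extends      : L′ Extends L
  open _Extends_ extends public
  field
    conservative : ∀ Γ C → Γ L.⊢ C ⇔ image (embed incl) Γ L′.⊢ embed incl C

-- D may be empty; conservativity of fibring needs a designated value, so that
-- p ⊢ q without ⊢ q is excluded.

record Matrix {Sym : Set} (ar : Sym → ℕ) (S : Signature Sym) : Set₁ where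
  field
    V  : Set
    D  : Pred V 0ℓ
    op : (c : Sym) → .(c ∈ S) → Vec V (ar c) → V

record Valuation {Sym : Set} {ar : Sym → ℕ} {S : Signature Sym}
                 (𝕄 : Matrix ar S) : Set where
  open Matrix 𝕄
  field
    ⟦_⟧ : Formula ar S → V
    hom : ∀ c .(m : c ∈ S) As → ⟦ app c m As ⟧ ≡ op c m (Vec.map ⟦_⟧ As)

_Characterizes_ : Matrix ar S → Logic ar S → Set₁
𝕄 Characterizes L =
  ∀ Γ C → Γ ⊢ C ⇔ (∀ (v : Valuation 𝕄) → let open Valuation v in
                     (∀ {G} → G ∈ Γ → ⟦ G ⟧ ∈ D) → ⟦ C ⟧ ∈ D)
  where
  open Logic L
  open Matrix 𝕄

module _ {Sym : Set} {ar : Sym → ℕ} {S₁ S₂ : Signature Sym}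
         (L₁ : Logic ar S₁) (L₂ : Logic ar S₂) where
  private
    module L₁ = Logic L₁
    module L₂ = Logic L₂

  infix 4 _⊢•_

  data _⊢•_ : FormulaSet ar (S₁ ∪ S₂) → Formula ar (S₁ ∪ S₂) → Set₁ where
    fromˡ : ∀ {Γ C} → Γ L₁.⊢ C → image (embed inj₁) Γ ⊢• embed inj₁ C
    fromʳ : ∀ {Γ C} → Γ L₂.⊢ C → image (embed inj₂) Γ ⊢• embed inj₂ C
    resp  : ∀ {Γ Δ C} → Γ ≐ Δ → Γ ⊢• C → Δ ⊢• C
    R     : ∀ {Γ C} → Γ ∪ ｛ C ｝ ⊢• C
    M     : ∀ {Γ Δ C} → Γ ⊢• C → Γ ∪ Δ ⊢• C
    T     : ∀ {Γ Δ C} → (∀ {D} → D ∈ Δ → Γ ⊢• D) → Γ ∪ Δ ⊢• C → Γ ⊢• C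
    SI    : ∀ {Γ C} σ → Γ ⊢• C → image (subst σ) Γ ⊢• subst σ C

  infixl 6 _•_

  _•_ : Logic ar (S₁ ∪ S₂)
  _•_ = record { _⊢_ = _⊢•_ ; resp = resp ; R = R ; M = M ; T = T ; SI = SI }

  •-least : (L : Logic ar (S₁ ∪ S₂)) → let open Logic L in
            (∀ {Γ C} → Γ L₁.⊢ C → image (embed inj₁) Γ ⊢ embed inj₁ C) →
            (∀ {Γ C} → Γ L₂.⊢ C → image (embed inj₂) Γ ⊢ embed inj₂ C) →
            ∀ {Γ C} → Γ ⊢• C → Γ ⊢ C
  •-least L l r = go
    where
    module L = Logic L
    go : ∀ {Γ C} → Γ ⊢• C → Γ L.⊢ C
    go (fromˡ d)  = l d
    go (fromʳ d)  = r d
    go (resp e d) = L.resp e (go d)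
    go R          = L.R
    go (M d)      = L.M (go d)
    go (T ds d)   = L.T (λ D∈Δ → go (ds D∈Δ)) (go d)
    go (SI σ d)   = L.SI σ (go d)

{-# OPTIONS --safe #-}

-- Let Θ be the set of consequences of Γ in L₁ • L₂.  Reading every subformula
-- whose head is not in S₁ as a variable, for which there are enough variables
-- by countability, turns Θ into a set of S₁-formulas, and the family of all
-- 𝕄a-valuations that designate this set designates nothing else, because La is
-- conservative over L₁; likewise for 𝕄b.  The two families extend jointly to
-- all formulas over Sa ∪ Sb: on a formula outside the smaller language one of
-- them is computed by its matrix, and the other is given a constantly
-- designated value or the value of some fixed formula outside Θ so that both
-- keep designating the same formulas.  The formulas so designated are closed
-- under every instance of La and of Lb, hence under La • Lb, and among the
-- formulas over S₁ ∪ S₂ they are exactly those of Θ.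
module Submission where

open import Defs
open import Axiom.ExcludedMiddle using (ExcludedMiddle)
open import Data.Empty using (⊥-elim-irr)
open import Data.Nat.Base using (ℕ; zero)
open import Data.Nat.Properties using (suc-injective)
open import Data.Product.Base as Product using (_×_; _,_; ∃; proj₁; proj₂)
open import Data.Sum.Base as Sum using (inj₁; inj₂; [_,_]′; fromInj₁; fromInj₂)
open import Data.Vec.Base as Vec using (Vec; []; _∷_)
open import Data.Vec.Properties using (map-cong; map-∘)
open import Function.Base using (_∘_; id)
open import Function.Bundles using (_⇔_; mk⇔; module Equivalence)
open import Level using (lift; lower; 0ℓ; suc)
open import Relation.Binary.PropositionalEquality as ≡
  using (_≡_; _≢_; _≗_; refl; sym; trans; cong; cong₂; module ≡-Reasoning)
open import Relation.Nullary using (Dec; yes; no; contradiction; recompute)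
open import Relation.Nullary.Decidable using (True; toWitness; fromWitness; map′)
open import Relation.Unary
  using (Pred; Decidable; Satisfiable; _∈_; _∉_; _⊆_; _≐_; _∪_; ｛_｝; _⊥_)

open Equivalence using (to; from)

private variable
  A B : Set
  Sym : Set
  ar : Sym → ℕ
  S S′ S″ S₀ U : Signature Sym

lower-em : ExcludedMiddle (suc 0ℓ) → ExcludedMiddle 0ℓ
lower-em em = map′ lower lift em

-- Images and embeddings

image-mono : (f : A → B) {P Q : Pred A 0ℓ} → P ⊆ Q → image f P ⊆ image f Q
image-mono f P⊆Q (x , x∈P , e) = x , P⊆Q x∈P , e

image-∪ : (f : A → B) {P Q : Pred A 0ℓ} → image f (P ∪ Q) ≐ image f P ∪ image f Q
image-∪ f =
  (λ { (x , inj₁ x∈P , e) → inj₁ (x , x∈P , e)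
     ; (x , inj₂ x∈Q , e) → inj₂ (x , x∈Q , e) }) ,
  [ image-mono f inj₁ , image-mono f inj₂ ]′

image-∪-｛｝ : (f : A → B) {P : Pred A 0ℓ} {x : A} →
              image f P ∪ ｛ f x ｝ ≐ image f (P ∪ ｛ x ｝)
image-∪-｛｝ f {x = x} =
  [ image-mono f inj₁ , (λ e → x , inj₂ refl , e) ]′ ,
  λ { (y , inj₁ y∈P , e) → inj₁ (y , y∈P , e)
    ; (_ , inj₂ refl , e) → inj₂ e }

image-∘-⊆ : ∀ {A B B′ E : Set} {f : A → B} {g : B → E} {f′ : A → B′} {g′ : B′ → E} →
            g ∘ f ≗ g′ ∘ f′ → {P : Pred A 0ℓ} →
            image g (image f P) ⊆ image g′ (image f′ P)
image-∘-⊆ {f′ = f′} h (_ , (x , x∈P , refl) , refl) =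
  f′ x , (x , x∈P , refl) , sym (h x)

image-∘ : ∀ {A B B′ E : Set} {f : A → B} {g : B → E} {f′ : A → B′} {g′ : B′ → E} →
          g ∘ f ≗ g′ ∘ f′ → {P : Pred A 0ℓ} →
          image g (image f P) ≐ image g′ (image f′ P)
image-∘ h = image-∘-⊆ h , image-∘-⊆ (sym ∘ h)

subst*-map : ∀ {n} (σ : ℕ → Formula ar S) (As : Vec (Formula ar S) n) →
             subst* σ As ≡ Vec.map (subst σ) As
subst*-map σ []       = refl
subst*-map σ (A ∷ As) = cong (subst σ A ∷_) (subst*-map σ As)

embed*-map : ∀ {n} (i : S ⊆ S′) (As : Vec (Formula ar S) n) →
             embed* {ar = ar} i As ≡ Vec.map (embed i) As
embed*-map i []       = refl
embed*-map i (A ∷ As) = cong (embed i A ∷_) (embed*-map i As)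

mutual
  subst-var : (A : Formula ar S) → subst var A ≡ A
  subst-var (var p)      = refl
  subst-var (app c m As) = cong (app c m) (subst*-var As)

  subst*-var : ∀ {n} (As : Vec (Formula ar S) n) → subst* var As ≡ As
  subst*-var []       = refl
  subst*-var (A ∷ As) = cong₂ _∷_ (subst-var A) (subst*-var As)

mutual
  subst-∘ : ∀ (σ τ : ℕ → Formula ar S) A → subst σ (subst τ A) ≡ subst (subst σ ∘ τ) A
  subst-∘ σ τ (var p)      = refl
  subst-∘ σ τ (app c m As) = cong (app c m) (subst*-∘ σ τ As)

  subst*-∘ : ∀ {n} (σ τ : ℕ → Formula ar S) (As : Vec (Formula ar S) n) →
             subst* σ (subst* τ As) ≡ subst* (subst σ ∘ τ) As
  subst*-∘ σ τ []       = refl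
  subst*-∘ σ τ (A ∷ As) = cong₂ _∷_ (subst-∘ σ τ A) (subst*-∘ σ τ As)

-- The inclusions need not be related: embeddings ignore membership proofs.

mutual
  embed-∘ : (i : S ⊆ S′) (j : S′ ⊆ S″) (k : S ⊆ S″) (A : Formula ar S) →
            embed j (embed i A) ≡ embed k A
  embed-∘ i j k (var p)      = refl
  embed-∘ i j k (app c m As) = cong (app c _) (embed*-∘ i j k As)

  embed*-∘ : ∀ {n} (i : S ⊆ S′) (j : S′ ⊆ S″) (k : S ⊆ S″) (As : Vec (Formula ar S) n) →
             embed* {ar = ar} j (embed* i As) ≡ embed* k As
  embed*-∘ i j k []       = refl
  embed*-∘ i j k (A ∷ As) = cong₂ _∷_ (embed-∘ i j k A) (embed*-∘ i j k As)

mutual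
  embed-subst : (i : S ⊆ S′) (σ : ℕ → Formula ar S) (A : Formula ar S) →
                embed {ar = ar} i (subst σ A) ≡ subst (λ p → embed i (σ p)) (embed i A)
  embed-subst i σ (var p)      = refl
  embed-subst i σ (app c m As) = cong (app c _) (embed*-subst i σ As)

  embed*-subst : ∀ {n} (i : S ⊆ S′) (σ : ℕ → Formula ar S) (As : Vec (Formula ar S) n) →
                 embed* {ar = ar} i (subst* σ As) ≡ subst* (λ p → embed i (σ p)) (embed* i As)
  embed*-subst i σ []       = refl
  embed*-subst i σ (A ∷ As) = cong₂ _∷_ (embed-subst i σ A) (embed*-subst i σ As)

-- Stated for arbitrary argument vectors so that matching on `refl` can unify them, which it could
-- not do with the computed vectors `embed* i As` of `embed-injective`.
app-injective : ∀ {c d : Sym} .{m : c ∈ S} .{n : d ∈ S}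
                {As : Vec (Formula ar S) (ar c)} {Bs : Vec (Formula ar S) (ar d)} →
                app c m As ≡ app d n Bs →
                ∃ λ (c≡d : c ≡ d) → ≡.subst (λ c → Vec (Formula ar S) (ar c)) c≡d As ≡ Bs
app-injective refl = refl , refl

mutual
  embed-injective : ∀ (i : S ⊆ S′) (A B : Formula ar S) → embed i A ≡ embed i B → A ≡ B
  embed-injective i (var p)      (var .p)     refl = refl
  embed-injective i (app c m As) (app d n Bs) e with app-injective e
  ... | refl , e′ = cong (app c m) (embed*-injective i As Bs e′)

  embed*-injective : ∀ {n} (i : S ⊆ S′) (As Bs : Vec (Formula ar S) n) →
                     embed* {ar = ar} i As ≡ embed* i Bs → As ≡ Bs
  embed*-injective i []       []       e = refl
  embed*-injective i (A ∷ As) (B ∷ Bs) e =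
    cong₂ _∷_ (embed-injective i A B (cong Vec.head e))
              (embed*-injective i As Bs (cong Vec.tail e))

-- Countability

double : ℕ → ℕ
double zero    = zero
double (ℕ.suc n) = ℕ.suc (ℕ.suc (double n))

double-injective : ∀ m n → double m ≡ double n → m ≡ n
double-injective zero    zero    e = refl
double-injective (ℕ.suc m) (ℕ.suc n) e =
  cong ℕ.suc (double-injective m n (suc-injective (suc-injective e)))

odd≢even : ∀ m n → ℕ.suc (double m) ≢ double n
odd≢even (ℕ.suc m) (ℕ.suc n) e = odd≢even m n (suc-injective (suc-injective e))

-- The value is 2^m (2n + 1), which is odd exactly when `m` is zero.
pair : ℕ → ℕ → ℕ
pair zero    n = ℕ.suc (double n)
pair (ℕ.suc m) n = double (pair m n)

pair-injective : ∀ m m′ {n n′} → pair m n ≡ pair m′ n′ → m ≡ m′ × n ≡ n′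
pair-injective zero    zero     e = refl , double-injective _ _ (suc-injective e)
pair-injective zero    (ℕ.suc m′) e = contradiction e (odd≢even _ (pair m′ _))
pair-injective (ℕ.suc m) zero     e = contradiction (sym e) (odd≢even _ (pair m _))
pair-injective (ℕ.suc m) (ℕ.suc m′) e =
  Product.map₁ (cong ℕ.suc) (pair-injective m m′ (double-injective _ _ e))

Countable-∪ : Decidable S → Countable S → Countable S′ → Countable (S ∪ S′)
Countable-∪ {S = S} {S′ = S′} S? (code , code-inj) (code′ , code′-inj) = code∪ , inj
  where
  -- A symbol of both signatures takes its code from `S`, so overlapping signatures cause no clash.
  tag : ∀ c → Dec (c ∈ S) → ℕ
  tag c (yes _) = pair 0 (code c)
  tag c (no _)  = pair 1 (code′ c)

  code∪ : _ → ℕ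
  code∪ c = tag c (S? c)

  inj : ∀ {c d} → c ∈ S ∪ S′ → d ∈ S ∪ S′ → code∪ c ≡ code∪ d → c ≡ d
  inj {c} {d} c∈ d∈ e with S? c | S? d
  ... | yes p | yes q = code-inj p q (proj₂ (pair-injective 0 0 e))
  ... | yes _ | no _  = contradiction (proj₁ (pair-injective 0 1 e)) λ ()
  ... | no _  | yes _ = contradiction (proj₁ (pair-injective 1 0 e)) λ ()
  ... | no p  | no q  =
    code′-inj (fromInj₂ (λ c∈S → contradiction c∈S p) c∈)
              (fromInj₂ (λ d∈S → contradiction d∈S q) d∈)
              (proj₂ (pair-injective 1 1 e))

module Coding {Sym : Set} {ar : Sym → ℕ} {S : Signature Sym}
              (S? : Decidable S) (countable : Countable S) where
  private
    symbol = proj₁ countable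
    symbol-injective = proj₂ countable

  mutual
    -- The first component makes codes of variables odd and codes of applications even.
    code : Formula ar S → ℕ
    code (var p)      = pair 0 p
    code (app c m As) = pair (ℕ.suc (symbol c)) (code* As)

    code* : ∀ {n} → Vec (Formula ar S) n → ℕ
    code* []       = 0
    code* (A ∷ As) = pair (code A) (code* As)

  mutual
    code-injective : ∀ A B → code A ≡ code B → A ≡ B
    code-injective (var p) (var q) e = cong var (proj₂ (pair-injective 0 0 e))
    code-injective (var p) (app d n Bs) e =
      contradiction e (odd≢even p (pair (symbol d) (code* Bs)))
    code-injective (app c m As) (var q) e =
      contradiction (sym e) (odd≢even q (pair (symbol c) (code* As)))
    code-injective (app c m As) (app d n Bs) e 
      with pair-injective (ℕ.suc (symbol c)) (ℕ.suc (symbol d)) e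
    ... | e₁ , e₂
      -- Formulas store membership irrelevantly; decidability recovers the proofs that injectivity
      -- on `S` asks for.
      with symbol-injective (recompute (S? c) m) (recompute (S? d) n) (suc-injective e₁)
    ... | refl = cong (app c m) (code*-injective As Bs e₂)

    code*-injective : ∀ {n} (As Bs : Vec (Formula ar S) n) → code* As ≡ code* Bs → As ≡ Bs
    code*-injective []       []       e = refl
    code*-injective (A ∷ As) (B ∷ Bs) e =
      let e₁ , e₂ = pair-injective (code A) (code B) e
      in cong₂ _∷_ (code-injective A B e₁) (code*-injective As Bs e₂)

  -- The default `var n` never matters: `decode` acts on the variables of skeletons, and these are
  -- all codes.
  decode : ExcludedMiddle 0ℓ → ℕ → Formula ar S
  decode em n with em {∃ λ A → code A ≡ n}
  ... | yes (A , _) = A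
  ... | no _        = var n

  decode-code : ∀ (em : ExcludedMiddle 0ℓ) A → decode em (code A) ≡ A
  decode-code em A with em {∃ λ B → code B ≡ code A}
  ... | yes (B , e) = code-injective B A e
  ... | no ∄        = contradiction (A , refl) ∄

-- Derived rules and restriction to a sublanguage

module _ {Sym : Set} {ar : Sym → ℕ} {S : Signature Sym} (L : Logic ar S) where
  private module L = Logic L
  open L using (_⊢_)

  assumption : ∀ {Γ C} → C ∈ Γ → Γ ⊢ C
  assumption C∈Γ = L.resp ([ id , (λ { refl → C∈Γ }) ]′ , inj₁) L.R

  cut : ∀ {Γ Δ C} → (∀ {D} → D ∈ Δ → Γ ⊢ D) → Δ ⊢ C → Γ ⊢ C
  cut ds d = L.T ds (L.resp (Sum.swap , Sum.swap) (L.M d))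

-- Lets `•-least` compare fibrings over different signatures. `SI` survives because embedding turns
-- `σ` into a substitution of the larger language.
restrict : S ⊆ S′ → Logic ar S′ → Logic ar S
restrict i L = record
  { _⊢_  = λ Γ C → image (embed i) Γ ⊢ embed i C
  ; resp = λ (Γ⊆Δ , Δ⊆Γ) → L.resp (image-mono _ Γ⊆Δ , image-mono _ Δ⊆Γ)
  ; R    = L.resp (image-∪-｛｝ _) L.R
  ; M    = λ d → L.resp (Product.swap (image-∪ _)) (L.M d)
  ; T    = λ ds d → L.T (λ { (_ , D∈Δ , refl) → ds D∈Δ }) (L.resp (image-∪ _) d)
  ; SI   = λ {Γ} {C} σ d → ≡.subst (_ ⊢_) (sym (embed-subst i σ C))
             (L.resp (image-∘ (sym ∘ embed-subst i σ)) (L.SI (embed i ∘ σ) d))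
  }
  where
  module L = Logic L
  open L using (_⊢_)

-- Semantics

module Skeleton {Sym : Set} {ar : Sym → ℕ} {S U : Signature Sym}
                (U? : Decidable U) (code : Formula ar S → ℕ) where

  mutual
    -- Even a variable is renamed to its code, so that it cannot collide with a variable standing
    -- for a subformula with a foreign head.
    skeleton : Formula ar S → Formula ar U
    skeleton (var p)      = var (code (var p))
    skeleton (app c m As) = skeleton-app c m As (U? c)

    skeleton-app : ∀ c → .(c ∈ S) → Vec (Formula ar S) (ar c) → Dec (c ∈ U) → Formula ar U
    skeleton-app c m As (yes c∈U) = app c c∈U (skeleton* As)
    skeleton-app c m As (no _)    = var (code (app c m As))

    skeleton* : ∀ {n} → Vec (Formula ar S) n → Vec (Formula ar U) n
    skeleton* []       = []
    skeleton* (A ∷ As) = skeleton A ∷ skeleton* As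

  skeleton*-map : ∀ {n} (As : Vec (Formula ar S) n) → skeleton* As ≡ Vec.map skeleton As
  skeleton*-map []       = refl
  skeleton*-map (A ∷ As) = cong (skeleton A ∷_) (skeleton*-map As)

  skeleton-∈ : ∀ {c} (u : c ∈ U) .(m : c ∈ S) As →
               skeleton (app c m As) ≡ app c u (Vec.map skeleton As)
  skeleton-∈ {c} u m As with U? c
  ... | yes _  = cong (app c _) (skeleton*-map As)
  ... | no c∉U = contradiction u c∉U

  module _ (i : U ⊆ S) (decode : ℕ → Formula ar S)
           (decode-code : ∀ A → decode (code A) ≡ A) where

    mutual
      -- Each formula is thus a substitution instance of its skeleton, so a derivation between
      -- skeletons yields one between the original formulas.
      decode-skeleton : ∀ A → subst decode (embed i (skeleton A)) ≡ A
      decode-skeleton (var p) = decode-code (var p)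
      decode-skeleton (app c m As) with U? c
      ... | yes _ = cong (app c _) (decode-skeleton* As)
      ... | no _  = decode-code (app c m As)

      decode-skeleton* : ∀ {n} (As : Vec (Formula ar S) n) →
                         subst* decode (embed* i (skeleton* As)) ≡ As
      decode-skeleton* []       = refl
      decode-skeleton* (A ∷ As) = cong₂ _∷_ (decode-skeleton A) (decode-skeleton* As)

-- hom constrains only symbols in both U and S, so that S may be smaller than U
-- (in canonical) as well as larger (in Extension).

record Valuations {Sym : Set} {ar : Sym → ℕ} {U : Signature Sym}
                  (𝕄 : Matrix ar U) (S : Signature Sym) : Set₁ where
  open Matrix 𝕄
  field
    Index : Set
    ⟦_⟧   : Formula ar S → Index → V
    hom   : ∀ {c} .(u : c ∈ U) .(m : c ∈ S) As k →
            ⟦ app c m As ⟧ k ≡ op c u (Vec.map (λ A → ⟦ A ⟧ k) As)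

  -- The family acts as a single map into a power of `𝕄`, in which designated means designated at
  -- every index.
  Designated : Pred (Formula ar S) 0ℓ
  Designated A = ∀ k → ⟦ A ⟧ k ∈ D

-- `σ` takes values in the larger language, since in a fibring the rules of either logic apply to
-- mixed formulas too.
ClosedUnder : {Sym : Set} {ar : Sym → ℕ} {S U : Signature Sym} →
              Logic ar U → U ⊆ S → FormulaSet ar S → Set₁
ClosedUnder L i X = ∀ {Γ C} → Γ ⊢ C → ∀ σ →
  (∀ {G} → G ∈ Γ → subst σ (embed i G) ∈ X) → subst σ (embed i C) ∈ X
  where open Logic L using (_⊢_)

-- At a fixed index, translating by `embed i` and `σ` and then evaluating is a valuation of `𝕄`, to
-- which soundness applies.
designated-closed :
  (L : Logic ar U) (𝕄 : Matrix ar U) → 𝕄 Characterizes L →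
  (w : Valuations 𝕄 S) (i : U ⊆ S) → ClosedUnder L i (Valuations.Designated w)
designated-closed L 𝕄 char w i {Γ} {C} d σ Γ⊆X k = to (char Γ C) d v (λ G∈Γ → Γ⊆X G∈Γ k)
  where
  open Matrix 𝕄
  open Valuations w
  open ≡-Reasoning

  v : Valuation 𝕄
  v = record
    { ⟦_⟧ = λ A → ⟦ subst σ (embed i A) ⟧ k
    ; hom = λ c u As → begin
        ⟦ app c _ (subst* σ (embed* i As)) ⟧ k
          ≡⟨ hom u _ _ k ⟩
        op c _ (Vec.map (λ A → ⟦ A ⟧ k) (subst* σ (embed* i As)))
          ≡⟨ cong (λ Bs → op c u (Vec.map (λ A → ⟦ A ⟧ k) Bs))
               (trans (subst*-map σ _) (cong (Vec.map (subst σ)) (embed*-map i As))) ⟩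
        op c _ (Vec.map (λ A → ⟦ A ⟧ k) (Vec.map (subst σ) (Vec.map (embed i) As)))
          ≡⟨ cong (op c u) (trans (sym (map-∘ _ _ _)) (sym (map-∘ _ _ _))) ⟩
        op c _ (Vec.map (λ A → ⟦ subst σ (embed i A) ⟧ k) As)
          ∎
    }

closed-resp : (L : Logic ar U) (i : U ⊆ S) {X Y : FormulaSet ar S} →
              X ≐ Y → ClosedUnder L i X → ClosedUnder L i Y
closed-resp L i (X⊆Y , Y⊆X) closed d σ h = X⊆Y (closed d σ (λ G∈Γ → Y⊆X (h G∈Γ)))

-- Induction on the derivation, for all `σ` at once: `SI` is absorbed by composing `σ` with the
-- substitution of the rule.
•-closed : {S₁ S₂ : Signature Sym} (L₁ : Logic ar S₁) (L₂ : Logic ar S₂) →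
           (i : S₁ ⊆ S) (j : S₂ ⊆ S) (k : S₁ ∪ S₂ ⊆ S) (X : FormulaSet ar S) →
           ClosedUnder L₁ i X → ClosedUnder L₂ j X → ClosedUnder (L₁ • L₂) k X
•-closed {ar = ar} {S = S} {S₁ = S₁} {S₂ = S₂} L₁ L₂ i j k X close₁ close₂ = go
  where
  push : ∀ {U} (l : U ⊆ S) (m : U ⊆ S₁ ∪ S₂) σ (A : Formula ar U) →
         subst σ (embed k (embed m A)) ∈ X → subst σ (embed l A) ∈ X
  push l m σ A = ≡.subst (λ B → subst σ B ∈ X) (embed-∘ m k l A)

  pull : ∀ {U} (l : U ⊆ S) (m : U ⊆ S₁ ∪ S₂) σ (A : Formula ar U) →
         subst σ (embed l A) ∈ X → subst σ (embed k (embed m A)) ∈ X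
  pull l m σ A = ≡.subst (λ B → subst σ B ∈ X) (sym (embed-∘ m k l A))

  instance-∘ : ∀ σ τ A → subst σ (embed k (subst τ A)) ≡
                         subst (λ p → subst σ (embed k (τ p))) (embed k A)
  instance-∘ σ τ A = trans (cong (subst σ) (embed-subst k τ A)) (subst-∘ σ _ (embed k A))

  go : ClosedUnder (L₁ • L₂) k X
  go (fromˡ {C = C} d) σ h = pull i inj₁ σ C
    (close₁ d σ λ {G} G∈Γ → push i inj₁ σ G (h (G , G∈Γ , refl)))
  go (fromʳ {C = C} d) σ h = pull j inj₂ σ C
    (close₂ d σ λ {G} G∈Γ → push j inj₂ σ G (h (G , G∈Γ , refl)))
  go (resp (Γ⊆Δ , _) d) σ h = go d σ (λ G∈Γ → h (Γ⊆Δ G∈Γ))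
  go R σ h = h (inj₂ refl)
  go (M d) σ h = go d σ (λ G∈Γ → h (inj₁ G∈Γ))
  go (T ds d) σ h = go d σ [ h , (λ D∈Δ → go (ds D∈Δ) σ h) ]′
  go (SI {C = C} τ d) σ h = ≡.subst X (sym (instance-∘ σ τ C))
    (go d _ λ {G} G∈Γ → ≡.subst X (instance-∘ σ τ G) (h (G , G∈Γ , refl)))

-- Canonical families of valuations

record Canonical {Sym : Set} {ar : Sym → ℕ} {S U : Signature Sym}
                 (𝕄 : Matrix ar U) (Θ : FormulaSet ar S) : Set₁ where
  field
    valuations : Valuations 𝕄 S
  open Valuations valuations public
  field
    designates : ∀ A → A ∈ Designated ⇔ A ∈ Θ

-- If every valuation designating the skeletons of `Θ` designates that of `A`, then characterization
-- gives a derivation in `L′`, conservativity moves it to `L`, and decoding its variables gives an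
-- instance under which `Θ` is closed.
canonical :
  ExcludedMiddle 0ℓ → Countable S →
  (L : Logic ar S₀) (L′ : Logic ar U) → L′ ConservativelyExtends L →
  (𝕄 : Matrix ar U) → 𝕄 Characterizes L′ →
  (i : S₀ ⊆ S) → (∀ {c} → c ∈ U → c ∈ S → c ∈ S₀) →
  (Θ : FormulaSet ar S) → ClosedUnder L i Θ → Canonical 𝕄 Θ
canonical {S = S} {ar = ar} {S₀ = S₀} {U = U}
          em countable L L′ ext 𝕄 char i U∩S⊆S₀ Θ closed = record
  { valuations = record
    { Index = Index
    ; ⟦_⟧ = λ A (v , _) → Valuation.⟦_⟧ v (reading A)
    ; hom = λ u m As (v , _) → reading-hom v u m As
    }
  ; designates = λ A → mk⇔ (complete A) (λ A∈Θ (_ , v⊨Θ) → v⊨Θ A∈Θ)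
  }
  where
  open Matrix 𝕄
  open _ConservativelyExtends_ ext
  open Coding {ar = ar} {S = S} (λ _ → em) countable
  open Skeleton {ar = ar} {S = S} {U = S₀} (λ _ → em) code

  reading : Formula ar S → Formula ar U
  reading A = embed incl (skeleton A)

  -- Possibly empty; every formula is then designated, and `complete` puts every formula into `Θ`.
  Index : Set
  Index = ∃ λ (v : Valuation 𝕄) → ∀ {A} → A ∈ Θ → Valuation.⟦_⟧ v (reading A) ∈ D

  reading-hom : ∀ (v : Valuation 𝕄) {c} .(u : c ∈ U) .(m : c ∈ S) As →
                Valuation.⟦_⟧ v (reading (app c m As)) ≡
                op c u (Vec.map (λ A → Valuation.⟦_⟧ v (reading A)) As)
  reading-hom v {c} u m As = begin
    ⟦ embed incl (skeleton (app c m As)) ⟧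
      ≡⟨ cong (λ A → ⟦ embed incl A ⟧)
           -- A symbol of both `U` and `S` lies in `S₀`, so the skeleton keeps it as a head instead
           -- of hiding it in a variable, and the operation of `𝕄` acts on it.
           (skeleton-∈ (U∩S⊆S₀ (recompute em u) (recompute em m)) m As) ⟩
    ⟦ app c _ (embed* incl (Vec.map skeleton As)) ⟧
      ≡⟨ hom c u _ ⟩
    op c u (Vec.map ⟦_⟧ (embed* incl (Vec.map skeleton As)))
      ≡⟨ cong (op c u ∘ Vec.map ⟦_⟧) (trans (embed*-map incl _) (sym (map-∘ _ _ As))) ⟩
    op c u (Vec.map ⟦_⟧ (Vec.map reading As))
      ≡⟨ cong (op c u) (sym (map-∘ _ _ As)) ⟩
    op c u (Vec.map (⟦_⟧ ∘ reading) As) ∎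
    where
    open Valuation v
    open ≡-Reasoning

  σ : ℕ → Formula ar S
  σ = decode em

  recover : ∀ A → subst σ (embed i (skeleton A)) ≡ A
  recover = decode-skeleton i σ (decode-code em)

  complete : ∀ A → (∀ ((v , _) : Index) → Valuation.⟦_⟧ v (reading A) ∈ D) → A ∈ Θ
  complete A valid = ≡.subst Θ (recover A)
    (closed derivation σ λ { (B , B∈Θ , refl) → ≡.subst Θ (sym (recover B)) B∈Θ })
    where
    derivation : Logic._⊢_ L (image skeleton Θ) (skeleton A)
    derivation = from (conservative _ _) (from (char _ _) λ v v⊨Θ →
      valid (v , λ {B} B∈Θ → v⊨Θ (skeleton B , (B , B∈Θ , refl) , refl)))

-- Extension to the larger language

module Extension
  {Sym : Set} {ar : Sym → ℕ} {S Sa Sb : Signature Sym}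
  (em : ExcludedMiddle 0ℓ) (disjoint : Sa ⊥ Sb) (incl : S ⊆ Sa ∪ Sb)
  {𝕄a : Matrix ar Sa} {𝕄b : Matrix ar Sb}
  (da : Satisfiable (Matrix.D 𝕄a)) (db : Satisfiable (Matrix.D 𝕄b))
  {Θ : FormulaSet ar S} (a : Canonical 𝕄a Θ) (b : Canonical 𝕄b Θ)
  {C : Formula ar S} (C∉Θ : C ∉ Θ)
  where
  private
    module 𝕄a = Matrix 𝕄a
    module 𝕄b = Matrix 𝕄b
    module a = Canonical a
    module b = Canonical b

  Value : Set
  Value = (a.Index → 𝕄a.V) × (b.Index → 𝕄b.V)

  Designatedᵃ : Pred (a.Index → 𝕄a.V) 0ℓ
  Designatedᵃ x = ∀ k → x k ∈ 𝕄a.D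

  Designatedᵇ : Pred (b.Index → 𝕄b.V) 0ℓ
  Designatedᵇ y = ∀ k → y k ∈ 𝕄b.D

  -- The invariant of the construction: it makes the two families designate the same formulas.
  Agree : Value → Set
  Agree (x , y) = Designatedᵃ x ⇔ Designatedᵇ y

  -- A value in the power that is designated exactly when `P` holds. The negative case uses the
  -- whole vector `a.⟦ C ⟧`, which fails to be designated at some index because `C ∉ Θ`; no fixed
  -- undesignated truth-value is chosen.
  truthᵃ : {P : Set} → Dec P → a.Index → 𝕄a.V
  truthᵃ (yes _) k = proj₁ da
  truthᵃ (no _)    = a.⟦ C ⟧

  truthᵇ : {P : Set} → Dec P → b.Index → 𝕄b.V
  truthᵇ (yes _) k = proj₁ db
  truthᵇ (no _)    = b.⟦ C ⟧

  truthᵃ-designated : ∀ {P : Set} (P? : Dec P) → Designatedᵃ (truthᵃ P?) ⇔ P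
  truthᵃ-designated (yes p) = mk⇔ (λ _ → p) (λ _ _ → proj₂ da)
  truthᵃ-designated (no ¬p) =
    mk⇔ (λ h → contradiction (to (a.designates C) h) C∉Θ) (λ p → contradiction p ¬p)

  truthᵇ-designated : ∀ {P : Set} (P? : Dec P) → Designatedᵇ (truthᵇ P?) ⇔ P
  truthᵇ-designated (yes p) = mk⇔ (λ _ → p) (λ _ _ → proj₂ db)
  truthᵇ-designated (no ¬p) =
    mk⇔ (λ h → contradiction (to (b.designates C) h) C∉Θ) (λ p → contradiction p ¬p)

  base : Formula ar S → Value
  base A = a.⟦ A ⟧ , b.⟦ A ⟧

  base-agree : ∀ A → Agree (base A)
  base-agree A = mk⇔ (from (b.designates A) ∘ to (a.designates A))
                     (from (a.designates A) ∘ to (b.designates A))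

  applyᵃ : ∀ c → .(c ∈ Sa) → Vec Value (ar c) → a.Index → 𝕄a.V
  applyᵃ c u xs k = 𝕄a.op c u (Vec.map (λ x → proj₁ x k) xs)

  applyᵇ : ∀ c → .(c ∈ Sb) → Vec Value (ar c) → b.Index → 𝕄b.V
  applyᵇ c u xs k = 𝕄b.op c u (Vec.map (λ x → proj₂ x k) xs)

  Embedded : Formula ar (Sa ∪ Sb) → Set
  Embedded A = ∃ λ B → embed incl B ≡ A

  right : ∀ {c} → c ∈ Sa ∪ Sb → c ∉ Sa → c ∈ Sb
  right m c∉Sa = fromInj₂ (λ c∈Sa → contradiction c∈Sa c∉Sa) m

  eval-app : ∀ c .(m : c ∈ Sa ∪ Sb) {P : Pred (Formula ar S) 0ℓ} →
             Dec (∃ P) → Dec (c ∈ Sa) → Vec Value (ar c) → Value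
  -- Both components are prescribed here; `homᵃ` and `homᵇ` verify that they still obey the
  -- operations.
  eval-app c m (yes (B , _)) _          xs = base B
  eval-app c m (no _)        (yes c∈Sa) xs =
    let x = applyᵃ c c∈Sa xs in x , truthᵇ (em {Designatedᵃ x})
  eval-app c m (no _)        (no c∉Sa)  xs =
    let y = applyᵇ c (right m c∉Sa) xs in truthᵃ (em {Designatedᵇ y}) , y

  mutual
    eval : Formula ar (Sa ∪ Sb) → Value
    eval (var p)      = base (var p)
    eval (app c m As) = eval-app c m (em {Embedded (app c m As)}) em (eval* As)

    eval* : ∀ {n} → Vec (Formula ar (Sa ∪ Sb)) n → Vec Value n
    eval* []       = []
    eval* (A ∷ As) = eval A ∷ eval* As

  eval*-map : ∀ {n} (As : Vec (Formula ar (Sa ∪ Sb)) n) → eval* As ≡ Vec.map eval As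
  eval*-map []       = refl
  eval*-map (A ∷ As) = cong (eval A ∷_) (eval*-map As)

  eval-embed : ∀ A → eval (embed incl A) ≡ base A
  eval-embed (var p) = refl
  eval-embed (app c m As) with em {Embedded (embed incl (app c m As))}
  ... | yes (B , e) = cong base (embed-injective incl B _ e)
  ... | no ∄        = contradiction (app c m As , refl) ∄

  -- By this the set designated by `evalᵃ` is also the one designated by `evalᵇ`, and so inherits
  -- closure under both logics.
  eval-agree : ∀ A → Agree (eval A)
  eval-agree (var p) = base-agree (var p)
  eval-agree (app c m As) with em {Embedded (app c m As)} | em {c ∈ Sa}
  ... | yes (B , _) | _     = base-agree B
  ... | no _        | yes _ =
    mk⇔ (from (truthᵇ-designated em)) (to (truthᵇ-designated em))
  ... | no _        | no _  =
    mk⇔ (to (truthᵃ-designated em)) (from (truthᵃ-designated em))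

  homᵃ : ∀ {c} .(u : c ∈ Sa) .(m : c ∈ Sa ∪ Sb) As k →
         proj₁ (eval (app c m As)) k ≡ 𝕄a.op c u (Vec.map (λ A → proj₁ (eval A) k) As)
  homᵃ {c} u m As k with em {Embedded (app c m As)} | em {c ∈ Sa}
  ... | no _ | yes _    =
    cong (𝕄a.op c u) (trans (cong (Vec.map _) (eval*-map As)) (sym (map-∘ _ _ As)))
  ... | no _ | no c∉Sa  = ⊥-elim-irr (c∉Sa u)
  -- The arguments of an embedded application are themselves embedded, so `eval` reduces to `base`
  -- on them and the canonical family supplies the equation.
  ... | yes (app .c m′ Bs , refl) | _ = begin
    a.⟦ app c m′ Bs ⟧ k
      ≡⟨ a.hom u m′ Bs k ⟩
    𝕄a.op c u (Vec.map (λ B → a.⟦ B ⟧ k) Bs)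
      ≡⟨ cong (𝕄a.op c u) (map-cong (λ B → cong (λ x → proj₁ x k) (sym (eval-embed B))) Bs) ⟩
    𝕄a.op c u (Vec.map (λ B → proj₁ (eval (embed incl B)) k) Bs)
      ≡⟨ cong (𝕄a.op c u) (map-∘ _ _ Bs) ⟩
    𝕄a.op c u (Vec.map (λ A → proj₁ (eval A) k) (Vec.map (embed incl) Bs))
      ≡⟨ cong (𝕄a.op c u ∘ Vec.map _) (sym (embed*-map incl Bs)) ⟩
    𝕄a.op c u (Vec.map (λ A → proj₁ (eval A) k) (embed* incl Bs)) ∎
    where open ≡-Reasoning

  homᵇ : ∀ {c} .(u : c ∈ Sb) .(m : c ∈ Sa ∪ Sb) As k →
         proj₂ (eval (app c m As)) k ≡ 𝕄b.op c u (Vec.map (λ A → proj₂ (eval A) k) As)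
  homᵇ {c} u m As k with em {Embedded (app c m As)} | em {c ∈ Sa}
  ... | no _ | no _    =
    cong (𝕄b.op c u) (trans (cong (Vec.map _) (eval*-map As)) (sym (map-∘ _ _ As)))
  -- For a symbol of both signatures the second component would come from `truthᵇ` and not from
  -- `𝕄b`; disjointness rules this out.
  ... | no _ | yes c∈Sa = ⊥-elim-irr (disjoint (c∈Sa , u))
  ... | yes (app .c m′ Bs , refl) | _ = begin
    b.⟦ app c m′ Bs ⟧ k
      ≡⟨ b.hom u m′ Bs k ⟩
    𝕄b.op c u (Vec.map (λ B → b.⟦ B ⟧ k) Bs)
      ≡⟨ cong (𝕄b.op c u) (map-cong (λ B → cong (λ x → proj₂ x k) (sym (eval-embed B))) Bs) ⟩
    𝕄b.op c u (Vec.map (λ B → proj₂ (eval (embed incl B)) k) Bs)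
      ≡⟨ cong (𝕄b.op c u) (map-∘ _ _ Bs) ⟩
    𝕄b.op c u (Vec.map (λ A → proj₂ (eval A) k) (Vec.map (embed incl) Bs))
      ≡⟨ cong (𝕄b.op c u ∘ Vec.map _) (sym (embed*-map incl Bs)) ⟩
    𝕄b.op c u (Vec.map (λ A → proj₂ (eval A) k) (embed* incl Bs)) ∎
    where open ≡-Reasoning

  evalᵃ : Valuations 𝕄a (Sa ∪ Sb)
  evalᵃ = record { ⟦_⟧ = proj₁ ∘ eval ; hom = homᵃ }

  evalᵇ : Valuations 𝕄b (Sa ∪ Sb)
  evalᵇ = record { ⟦_⟧ = proj₂ ∘ eval ; hom = homᵇ }

  eval-designates : ∀ A → Designatedᵃ (proj₁ (eval (embed incl A))) ⇔ A ∈ Θ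
  eval-designates A rewrite eval-embed A = a.designates A

-- Excluded middle brings the set of consequences, which lives in Set₁, down
-- to a FormulaSet.

module _ {Sym : Set} {ar : Sym → ℕ} {S : Signature Sym}
         (em : ExcludedMiddle (suc 0ℓ)) (L : Logic ar S) where
  private module L = Logic L
  open L using (_⊢_)

  Consequences : FormulaSet ar S → FormulaSet ar S
  Consequences Γ C = True (em {Γ ⊢ C})

  -- `SI` in `L` gives the instance of the rule, and `cut` composes it with the derivations from
  -- `Γ`.
  consequences-closed :
    ∀ Γ (L₀ : Logic ar U) (i : U ⊆ S) →
    (∀ {Δ C} → Logic._⊢_ L₀ Δ C → image (embed i) Δ ⊢ embed i C) →
    ClosedUnder L₀ i (Consequences Γ)
  consequences-closed Γ L₀ i L₀⊆L d σ h = fromWitness (cut L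
    (λ { (_ , (G , G∈Δ , refl) , refl) → toWitness (h G∈Δ) })
    (L.SI σ (L₀⊆L d)))

-- Conservativity of fibring

proposition1 : ExcludedMiddle (suc 0ℓ) →
    {Sym : Set} {ar : Sym → ℕ} {Sa Sb S₁ S₂ : Signature Sym}
    (La : Logic ar Sa) (Lb : Logic ar Sb) (L₁ : Logic ar S₁) (L₂ : Logic ar S₂) →
    Countable S₁ → Countable S₂ →
    Sa ⊥ Sb →
    (𝕄a : Matrix ar Sa) → Satisfiable (Matrix.D 𝕄a) → 𝕄a Characterizes La →
    (𝕄b : Matrix ar Sb) → Satisfiable (Matrix.D 𝕄b) → 𝕄b Characterizes Lb →
    La ConservativelyExtends L₁ →
    Lb ConservativelyExtends L₂ →
    (La • Lb) ConservativelyExtends (L₁ • L₂)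
proposition1 em {ar = ar} {Sa} {Sb} {S₁} {S₂} La Lb L₁ L₂ countable₁ countable₂ disjoint
             𝕄a da chara 𝕄b db charb exta extb = record
  { extends      = record { incl = incl ; mono = mono }
  ; conservative = λ Γ C → mk⇔ mono (conservative Γ C)
  }
  where
  module exta = _ConservativelyExtends_ exta
  module extb = _ConservativelyExtends_ extb
  open Logic (L₁ • L₂) using (_⊢_)

  incl : S₁ ∪ S₂ ⊆ Sa ∪ Sb
  incl = Sum.map exta.incl extb.incl

  mono : ∀ {Γ C} → Γ ⊢ C → Logic._⊢_ (La • Lb) (image (embed incl) Γ) (embed incl C)
  -- What `La • Lb` derives between embedded formulas is a logic over the smaller language
  -- containing `L₁` and `L₂`, hence contains their fibring.
  mono = •-least L₁ L₂ (restrict incl (La • Lb))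
    (λ {_} {C} d → lift-along exta.incl inj₁ inj₁ C (fromˡ (exta.mono d)))
    (λ {_} {C} d → lift-along extb.incl inj₂ inj₂ C (fromʳ (extb.mono d)))
    where
    module L = Logic (La • Lb)
    lift-along : ∀ {S U} (i : S ⊆ U) (j : U ⊆ Sa ∪ Sb) (j′ : S ⊆ S₁ ∪ S₂)
                 {Γ : FormulaSet ar S} C →
                 image (embed j) (image (embed i) Γ) L.⊢ embed j (embed i C) →
                 image (embed incl) (image (embed j′) Γ) L.⊢ embed incl (embed j′ C)
    lift-along i j j′ C d = ≡.subst (_ L.⊢_) (square C) (L.resp (image-∘ square) d)
      where
      square : ∀ A → embed j (embed i A) ≡ embed incl (embed j′ A)
      square A = trans (embed-∘ i j (j ∘ i) A) (sym (embed-∘ j′ incl (j ∘ i) A))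

  em₀ : ExcludedMiddle 0ℓ
  em₀ = lower-em em

  conservative : ∀ Γ C → Logic._⊢_ (La • Lb) (image (embed incl) Γ) (embed incl C) → Γ ⊢ C
  conservative Γ C d with em {Γ ⊢ C}
  ... | yes Γ⊢C = Γ⊢C
  ... | no Γ⊬C  = contradiction (toWitness C∈Θ) Γ⊬C
    where
    Θ : FormulaSet ar (S₁ ∪ S₂)
    Θ = Consequences em (L₁ • L₂) Γ

    countable : Countable (S₁ ∪ S₂)
    countable = Countable-∪ (λ _ → em₀) countable₁ countable₂

    open Extension em₀ disjoint incl da db
      (canonical em₀ countable L₁ La exta 𝕄a chara inj₁
        -- A symbol of `Sa` in the smaller language comes from `S₁`, since one from `S₂` would also
        -- lie in `Sb`.
        (λ c∈Sa → fromInj₁ λ c∈S₂ → contradiction (c∈Sa , extb.incl c∈S₂) disjoint)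
        Θ (consequences-closed em (L₁ • L₂) Γ L₁ inj₁ fromˡ))
      (canonical em₀ countable L₂ Lb extb 𝕄b charb inj₂
        (λ c∈Sb → fromInj₂ λ c∈S₁ → contradiction (exta.incl c∈S₁ , c∈Sb) disjoint)
        Θ (consequences-closed em (L₁ • L₂) Γ L₂ inj₂ fromʳ))
      -- The assumed underivability makes `C` itself the fixed formula outside `Θ`.
      {C} (Γ⊬C ∘ toWitness)

    open Valuations evalᵃ using (Designated)

    closed : ClosedUnder (La • Lb) id Designated
    closed = •-closed La Lb inj₁ inj₂ id Designated
      (designated-closed La 𝕄a chara evalᵃ inj₁)
      (closed-resp Lb inj₂ ((λ {A} → from (eval-agree A)) , (λ {A} → to (eval-agree A)))
        (designated-closed Lb 𝕄b charb evalᵇ inj₂))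

    plain : ∀ A → subst var (embed id (embed incl A)) ≡ embed incl A
    plain A = trans (subst-var _) (embed-∘ incl id incl A)

    C∈Θ : C ∈ Θ
    -- The identity substitution applies `closed` to the given derivation: its premises lie in `Θ`
    -- and are designated, hence so is its conclusion.
    C∈Θ = to (eval-designates C) (≡.subst Designated (plain C)
      (closed d var λ { (G , G∈Γ , refl) → ≡.subst Designated (sym (plain G))
          (from (eval-designates G) (fromWitness (assumption (L₁ • L₂) G∈Γ))) }))
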